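{- The convex domination number of $\pi G$ cannot be bounded, either from above or from below, in terms of $\gamma_{con}(G)$. Precisely: (a) there is no function $f:\mathbb{N}\to\mathbb{N}$ such that $\gamma_{con}(\pi G)\le f(\gamma_{con}(G))$ for every connected graph $G$ and every permutation $\pi$ of $V_G$; and (b) there is no function $f:\mathbb{N}\to\mathbb{N}$ such that $\gamma_{con}(G)\le f(\gamma_{con}(\pi G))$ for every connected graph $G$ and every permutation $\pi$ of $V_G$.
   Context: Graphs are finite, simple, undirected and nonempty. For a graph $G$ with vertex set $V_G$ and a permutation $\pi$ of $V_G$, let $G'$ be a vertex-disjoint copy of $G$, with $v'$ the copy of $v$. The prism graph $\pi G$ has vertex set $V_G\cup V_{G'}$ and edge set $E_G\cup E_{G'}\cup\{u\,\pi(u)':u\in V_G\}$. A set $A$ of vertices is dominating if every vertex of the graph is in $A$ or adjacent to a vertex of $A$. In a connected graph, $A$ is convex if for every $u,v\in A$ it contains all vertices of every shortest $u$--$v$ path of the graph. $\gamma_{con}$ denotes the minimum cardinality of a convex dominating set. -}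

module Defs where

open import Data.Fin.Base using (Fin; splitAt)
open import Data.Fin.Permutation using (Permutation′; _⟨$⟩ʳ_)
open import Data.Fin.Properties using (_≟_)
open import Data.Fin.Subset using (Subset; _∈_; ∣_∣)
open import Data.List.Base using (List; []; _∷_)
open import Data.List.Relation.Unary.All using (All)
open import Data.List.Relation.Unary.Unique.Propositional using (Unique)
open import Data.Nat.Base using (ℕ; zero; suc; _+_; _≤_; NonZero)
open import Data.Product.Base using (_×_; ∃-syntax)
open import Data.Sum.Base using (_⊎_; inj₁; inj₂)
open import Relation.Binary.Core using (Rel)
open import Relation.Binary.Definitions using (Symmetric; Irreflexive; Decidable)
open import Relation.Binary.PropositionalEquality using (_≡_; refl)
open import Level using (0ℓ)

record Graph (n : ℕ) : Set₁ where
  field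
    nonempty : NonZero n
    Adj      : Rel (Fin n) 0ℓ
    adj?     : Decidable Adj
    symm     : Symmetric Adj
    irrefl   : Irreflexive _≡_ Adj

open Graph public

infixr 5 _∷_

data Walk {n : ℕ} (G : Graph n) : Fin n → Fin n → Set where
  [_] : ∀ u → Walk G u u
  _∷_ : ∀ {u v w} → Adj G u v → Walk G v w → Walk G u w

-- The number of edges.
length : ∀ {n} {G : Graph n} {u v} → Walk G u v → ℕ
length [ _ ]   = zero
length (_ ∷ p) = suc (length p)

vertices : ∀ {n} {G : Graph n} {u v} → Walk G u v → List (Fin n)
vertices [ u ]             = u ∷ []
vertices (_∷_ {u = u} _ p) = u ∷ vertices p

IsPath : ∀ {n} {G : Graph n} {u v} → Walk G u v → Set
IsPath p = Unique (vertices p)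

IsShortestPath : ∀ {n} {G : Graph n} {u v} → Walk G u v → Set
IsShortestPath {G = G} {u} {v} p =
  IsPath p × ((q : Walk G u v) → IsPath q → length p ≤ length q)

Connected : ∀ {n} → Graph n → Set
Connected G = ∀ u v → ∃[ p ] IsPath {G = G} {u} {v} p

Dominating : ∀ {n} → Graph n → Subset n → Set
Dominating G A = ∀ v → v ∈ A ⊎ (∃[ u ] u ∈ A × Adj G v u)

Convex : ∀ {n} → Graph n → Subset n → Set
Convex G A = ∀ {u v} → u ∈ A → v ∈ A →
  (p : Walk G u v) → IsShortestPath p → All (_∈ A) (vertices p)

ConvexDominating : ∀ {n} → Graph n → Subset n → Set
ConvexDominating G A = Convex G A × Dominating G A

-- γcon G is the number k.  It is a relation rather than a function; the
-- second component makes k unique, and the full vertex set is always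
-- convex dominating.
γcon_≔_ : ∀ {n} → Graph n → ℕ → Set
γcon_≔_ {n} G k =
    (∃[ A ] ConvexDominating G A × ∣ A ∣ ≡ k)
  × ((A : Subset n) → ConvexDominating G A → k ≤ ∣ A ∣)

-- inj₁ v stands for the vertex v of G, and inj₂ v for its copy v′.
module _ {n : ℕ} (G : Graph n) (π : Permutation′ n) where

  PrismAdj : Rel (Fin n ⊎ Fin n) 0ℓ
  PrismAdj (inj₁ u) (inj₁ v) = Adj G u v
  PrismAdj (inj₁ u) (inj₂ v) = v ≡ π ⟨$⟩ʳ u
  PrismAdj (inj₂ v) (inj₁ u) = v ≡ π ⟨$⟩ʳ u
  PrismAdj (inj₂ u) (inj₂ v) = Adj G u v

  prismAdj? : Decidable PrismAdj
  prismAdj? (inj₁ u) (inj₁ v) = adj? G u v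
  prismAdj? (inj₁ u) (inj₂ v) = v ≟ π ⟨$⟩ʳ u
  prismAdj? (inj₂ v) (inj₁ u) = v ≟ π ⟨$⟩ʳ u
  prismAdj? (inj₂ u) (inj₂ v) = adj? G u v

  prismAdj-sym : Symmetric PrismAdj
  prismAdj-sym {inj₁ _} {inj₁ _} e = symm G e
  prismAdj-sym {inj₁ _} {inj₂ _} e = e
  prismAdj-sym {inj₂ _} {inj₁ _} e = e
  prismAdj-sym {inj₂ _} {inj₂ _} e = symm G e

  prismAdj-irrefl : Irreflexive _≡_ PrismAdj
  prismAdj-irrefl {inj₁ _} refl e = irrefl G refl e
  prismAdj-irrefl {inj₂ _} refl e = irrefl G refl e

+-nonZero : ∀ {m} n → NonZero m → NonZero (m + n)
+-nonZero {suc _} _ _ = _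

-- Under splitAt, the first n vertices are those of G and the last n
-- vertices are their copies.
prism : ∀ {n} → Graph n → Permutation′ n → Graph (n + n)
prism {n} G π = record
  { nonempty = +-nonZero n (nonempty G)
  ; Adj      = λ x y → PrismAdj G π (splitAt n x) (splitAt n y)
  ; adj?     = λ x y → prismAdj? G π (splitAt n x) (splitAt n y)
  ; symm     = λ {x} {y} → prismAdj-sym G π {splitAt n x} {splitAt n y}
  ; irrefl   = λ { {x} refl → prismAdj-irrefl G π {splitAt n x} refl }
  }

{-# OPTIONS --safe #-}

-- Both parts exploit that a convex set containing u and v must swallow every
-- shortest u–v path.
-- (a) Hang m leaves on the end b₁ of a path b₁ b₂ b₃ and let π exchange b₁ and b₃.
-- {b₁, b₂} is convex dominating in G, but in πG the vertices b₁ and b₁′ are at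
-- distance 3, and b₁, leaf, leaf′, b₁′ is a shortest path for each leaf.  A set
-- avoiding b₁ or b₁′ needs a vertex in every column {leaf, leaf′}.
-- (b) Join two hubs a, y through many common neighbours and give each hub a
-- pendant vertex.  A convex dominating set of G contains a hub or its pendant at
-- both ends, hence all the common neighbours.  The permutation is chosen so that
-- {y, x₀, x₀′, a′} dominates πG and y, x₀, x₀′, a′ is the only shortest path from
-- y to a′, x₀ being one of the common neighbours.
module Submission where

open import Defs
open import Data.Bool.Base using (Bool; T; _∧_)
open import Data.Bool.ListAction using (all)
open import Data.Bool.Properties using (T-∧)
open import Data.Empty using (⊥)
open import Data.Fin.Base using (Fin; zero; suc; splitAt)
open import Data.Fin.Patterns
open import Data.Fin.Permutation using (Permutation′; permutation)
open import Data.Fin.Properties using (+↔⊎; splitAt-join; _≟_; suc-injective; 0≢1+n)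
open import Data.Fin.Subset using (Subset; inside; outside; _∈_; ∣_∣; ⁅_⁆; _∪_; ⋃; _-_; ⊤)
open import Data.Fin.Subset.Properties
  using (_∈?_; ∈⊤; x∈⁅x⁆; x∈⁅y⁆⇒x≡y; ∣⁅x⁆∣≡1; ∣⊥∣≡0; ∉⊥; x∈p∪q⁺; x∈p∪q⁻;
         x∈p∧x≢y⇒x∈p-y; x∈p⇒∣p-x∣<∣p∣)
open import Data.List.Base as List using (List; []; _∷_)
open import Data.List.Membership.Propositional using () renaming (_∈_ to _∈ˡ_; _∉_ to _∉ˡ_)
open import Data.List.Membership.Propositional.Properties using (∈-map⁺)
import Data.List.Membership.DecPropositional as DecMembership
open import Data.List.Properties using (length-map)
open import Data.List.Relation.Unary.All as All using (All; []; _∷_)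
open import Data.List.Relation.Unary.All.Properties using (all⁺; map⁻; ¬Any⇒All¬)
open import Data.List.Relation.Unary.AllPairs using ([]; _∷_; tail)
open import Data.List.Relation.Unary.Any using (here; there)
open import Data.Nat.Base using (ℕ; zero; suc; _+_; _≤_; _<_; _≤ᵇ_; z≤n; s≤s; s≤s⁻¹; NonZero; _⊔_)
open import Data.Nat.Induction using (<-wellFounded)
open import Data.Nat.Properties as ℕ using (module ≤-Reasoning)
open import Data.Nat.Tactic.RingSolver using (solve-∀)
open import Data.Product.Base as Product using (_×_; _,_; proj₁; proj₂; Σ-syntax; ∃-syntax)
open import Data.Sum.Base as Sum using (_⊎_; inj₁; inj₂; [_,_]′)
open import Data.Sum.Function.Propositional using (_⊎-↔_)
open import Data.Sum.Properties using (inj₁-injective; inj₂-injective)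
open import Data.Vec.Base using ([]; _∷_)
open import Function.Base using (_∘_; id)
open import Function.Bundles using (_↔_; Inverse; Equivalence)
open import Function.Definitions using (Injective)
open import Function.Properties.Inverse using (↔-sym; ↔-trans; ↔⇒↣; ↔-refl)
open import Induction.WellFounded using (Acc; acc)
open import Level using (0ℓ)
open import Relation.Binary.Core using (Rel)
open import Relation.Binary.Definitions using (DecidableEquality)
open import Relation.Binary.Construct.Closure.ReflexiveTransitive using (Star; ε; _◅_)
open import Relation.Binary.PropositionalEquality
open import Relation.Nullary using (¬_; yes; no; contradiction)
open import Relation.Nullary.Decidable using (via-injection; _⊎-dec_)

private
  variable
    m n : ℕ

-- Finite subsets

∣p∪q∣≤∣p∣+∣q∣ : (p q : Subset n) → ∣ p ∪ q ∣ ≤ ∣ p ∣ + ∣ q ∣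
∣p∪q∣≤∣p∣+∣q∣ []            []            = z≤n
∣p∪q∣≤∣p∣+∣q∣ (outside ∷ p) (outside ∷ q) = ∣p∪q∣≤∣p∣+∣q∣ p q
∣p∪q∣≤∣p∣+∣q∣ (outside ∷ p) (inside  ∷ q) =
  ℕ.≤-trans (s≤s (∣p∪q∣≤∣p∣+∣q∣ p q)) (ℕ.≤-reflexive (sym (ℕ.+-suc ∣ p ∣ ∣ q ∣)))
∣p∪q∣≤∣p∣+∣q∣ (inside  ∷ p) (outside ∷ q) = s≤s (∣p∪q∣≤∣p∣+∣q∣ p q)
∣p∪q∣≤∣p∣+∣q∣ (inside  ∷ p) (inside  ∷ q) =
  s≤s (ℕ.≤-trans (∣p∪q∣≤∣p∣+∣q∣ p q) (ℕ.+-monoʳ-≤ ∣ p ∣ (ℕ.n≤1+n ∣ q ∣)))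

fromList : List (Fin n) → Subset n
fromList = ⋃ ∘ List.map ⁅_⁆

∈-fromList⁺ : ∀ {x : Fin n} {xs} → x ∈ˡ xs → x ∈ fromList xs
∈-fromList⁺ (here refl) = x∈p∪q⁺ (inj₁ (x∈⁅x⁆ _))
∈-fromList⁺ (there x∈)  = x∈p∪q⁺ (inj₂ (∈-fromList⁺ x∈))

∈-fromList⁻ : ∀ {x : Fin n} xs → x ∈ fromList xs → x ∈ˡ xs
∈-fromList⁻ []       x∈ = contradiction x∈ ∉⊥
∈-fromList⁻ (y ∷ xs) x∈ with x∈p∪q⁻ ⁅ y ⁆ _ x∈
... | inj₁ x∈⁅y⁆ = here (x∈⁅y⁆⇒x≡y y x∈⁅y⁆)
... | inj₂ x∈xs  = there (∈-fromList⁻ xs x∈xs)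

∣fromList∣≤length : (xs : List (Fin n)) → ∣ fromList xs ∣ ≤ List.length xs
∣fromList∣≤length {n} []   = ℕ.≤-reflexive (∣⊥∣≡0 n)
∣fromList∣≤length (x ∷ xs) = begin
  ∣ ⁅ x ⁆ ∪ fromList xs ∣     ≤⟨ ∣p∪q∣≤∣p∣+∣q∣ ⁅ x ⁆ _ ⟩
  ∣ ⁅ x ⁆ ∣ + ∣ fromList xs ∣ ≡⟨ cong (_+ ∣ fromList xs ∣) (∣⁅x⁆∣≡1 x) ⟩
  suc ∣ fromList xs ∣         ≤⟨ s≤s (∣fromList∣≤length xs) ⟩
  suc (List.length xs)        ∎
  where open ≤-Reasoning

-- Induction on `m`: deleting `f zero` from `p` lowers its size, and by injectivity the other values
-- survive the deletion.
injection⇒≤∣p∣ : {p : Subset n} (f : Fin m → Fin n) → Injective _≡_ _≡_ f →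
                 (∀ i → f i ∈ p) → m ≤ ∣ p ∣
injection⇒≤∣p∣ {m = zero}  f inj f∈p = z≤n
injection⇒≤∣p∣ {m = suc m} f inj f∈p = ℕ.≤-trans
  (s≤s (injection⇒≤∣p∣ (f ∘ suc) (suc-injective ∘ inj) λ i →
    x∈p∧x≢y⇒x∈p-y (f∈p (suc i)) (0≢1+n ∘ sym ∘ inj)))
  (x∈p⇒∣p-x∣<∣p∣ (f∈p zero))

-- Walks and shortest paths

module _ {n : ℕ} {G : Graph n} where

  private
    variable
      s t u v w : Fin n
      h g f     : Fin n → ℕ

  infixr 5 _++_

  _++_ : Walk G u v → Walk G v w → Walk G u w
  [ _ ]   ++ q = q
  (e ∷ p) ++ q = e ∷ (p ++ q)

  length-++ : (p : Walk G u v) (q : Walk G v w) → length (p ++ q) ≡ length p + length q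
  length-++ [ _ ]   q = refl
  length-++ (_ ∷ p) q = cong suc (length-++ p q)

  reverse : Walk G u v → Walk G v u
  reverse [ u ]   = [ u ]
  reverse (e ∷ p) = reverse p ++ (symm G e ∷ [ _ ])

  length-reverse : (p : Walk G u v) → length (reverse p) ≡ length p
  length-reverse [ _ ]   = refl
  length-reverse (e ∷ p) = begin
    length (reverse p ++ (symm G e ∷ [ _ ])) ≡⟨ length-++ (reverse p) _ ⟩
    length (reverse p) + 1                   ≡⟨ ℕ.+-comm _ 1 ⟩
    suc (length (reverse p))                 ≡⟨ cong suc (length-reverse p) ⟩
    suc (length p)                           ∎
    where open ≡-Reasoning

  suffix : (p : Walk G u v) → IsPath p → w ∈ˡ vertices p →
           Σ[ q ∈ Walk G w v ] IsPath q × length q ≤ length p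
  suffix p@([ _ ]) path (here refl) = p , path , ℕ.≤-refl
  suffix p@(_ ∷ _) path (here refl) = p , path , ℕ.≤-refl
  suffix (_ ∷ p)   path (there w∈)  =
    Product.map₂ (Product.map₂ ℕ.m≤n⇒m≤1+n) (suffix p (tail path) w∈)

  -- Loop erasure: if the new first vertex `u` already occurs on the path obtained for the rest,
  -- everything before that occurrence is discarded.
  toPath : (p : Walk G u v) → Σ[ q ∈ Walk G u v ] IsPath q × length q ≤ length p
  toPath [ u ]         = [ u ] , ([] ∷ []) , z≤n
  toPath {u} (e ∷ p) with toPath p
  ... | q , path , q≤p with DecMembership._∈?_ _≟_ u (vertices q)
  ...   | yes u∈ = Product.map₂ (Product.map₂ λ r≤q → ℕ.m≤n⇒m≤1+n (ℕ.≤-trans r≤q q≤p))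
                     (suffix q path u∈)
  ...   | no u∉  = e ∷ q , ¬Any⇒All¬ _ u∉ ∷ path , s≤s q≤p

  -- Minimality among paths extends to all walks, because loop erasure never lengthens a walk.
  shortest-≤ : {p : Walk G u v} → IsShortestPath p → (q : Walk G u v) → length p ≤ length q
  shortest-≤ (_ , min) q with toPath q
  ... | r , path , r≤q = ℕ.≤-trans (min r path) r≤q

  rooted⇒connected : (r : Fin n) → (∀ u → Walk G u r) → Connected G
  rooted⇒connected r walk u v =
    Product.map₂ proj₁ (toPath (walk u ++ reverse (walk v)))

  -- Potentials that certify shortest paths

  -- Such functions stand in for distances. Adjacency is symmetric, so this one inequality bounds
  -- the change along an edge in both directions.
  Lipschitz : (Fin n → ℕ) → Set
  Lipschitz h = ∀ {u v} → Adj G u v → h u ≤ suc (h v)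

  descent : Lipschitz h → (p : Walk G u v) → h u ≤ length p + h v
  descent lip [ _ ]   = ℕ.≤-refl
  descent lip (e ∷ p) = ℕ.≤-trans (lip e) (s≤s (descent lip p))

  ascent : Lipschitz h → (p : Walk G u v) → h v ≤ length p + h u
  ascent {h = h} {u} {v} lip p =
    subst (λ k → h v ≤ k + h u) (length-reverse p) (descent lip (reverse p))

  private
    -- A walk is steep when `h` drops along it by at least its length, hence by exactly 1 at each
    -- edge; steepness therefore passes to the tail.
    steep-tail : Lipschitz h → (e : Adj G u w) (p : Walk G w v) →
                 length (e ∷ p) + h v ≤ h u → length p + h v ≤ h w
    steep-tail lip e p steep = s≤s⁻¹ (ℕ.≤-trans steep (lip e))

    steep-top : Lipschitz h → (p : Walk G u v) → length p + h v ≤ h u →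
                w ∈ˡ vertices p → h w ≤ h u
    steep-top lip [ _ ]   steep (here refl) = ℕ.≤-refl
    steep-top lip (e ∷ p) steep (here refl) = ℕ.≤-refl
    steep-top {h = h} {u = u} {v = v} {w = w} lip (_∷_ {v = u′} e p) steep (there w∈) = begin
      h w                  ≤⟨ steep-top lip p (steep-tail lip e p steep) w∈ ⟩
      h u′                 ≤⟨ descent lip p ⟩
      length p + h v       ≤⟨ ℕ.n≤1+n _ ⟩
      length (e ∷ p) + h v ≤⟨ steep ⟩
      h u                  ∎
      where open ≤-Reasoning

    steep⇒path : Lipschitz h → (p : Walk G u v) → length p + h v ≤ h u → IsPath p
    steep⇒path lip [ _ ]   steep = [] ∷ []
    steep⇒path {h = h} {u = u} lip (e ∷ p) steep = ¬Any⇒All¬ _ u∉p ∷ steep⇒path lip p steep′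
      where
      steep′ = steep-tail lip e p steep
      u∉p : u ∉ˡ vertices p
      -- If `u` recurred on `p`, then `h u` would be at most `length p + h v`, one less than
      -- steepness demands.
      u∉p u∈p = ℕ.<-irrefl refl
        (ℕ.≤-trans (s≤s (ℕ.≤-trans (steep-top lip p steep′ u∈p) (descent lip p))) steep)

  -- Every walk from `u` to `v` needs at least `h u` minus `h v` edges, and a steep one has no more
  -- than that.
  steep⇒shortest : Lipschitz h → (p : Walk G u v) → length p + h v ≤ h u → IsShortestPath p
  steep⇒shortest {h = h} {v = v} lip p steep =
    steep⇒path lip p steep ,
    λ q _ → ℕ.+-cancelʳ-≤ (h v) _ _ (ℕ.≤-trans steep (descent lip q))

  -- On the way from `u` to `w` the value of `g` grows by at most the edges used, and `f w` exceeds
  -- `f v` by at most the edges still to come.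
  detour : Lipschitz g → Lipschitz f → (p : Walk G u v) → w ∈ˡ vertices p →
           g w + f w ≤ g u + length p + f v
  detour {g} {f} {u = u} lipᵍ lipᶠ [ _ ] (here refl) =
    ℕ.+-monoˡ-≤ (f u) (ℕ.m≤m+n (g u) 0)
  detour {g} {f} {u = u} {v} lipᵍ lipᶠ p@(_ ∷ _) (here refl) = begin
    g u + f u              ≤⟨ ℕ.+-monoʳ-≤ (g u) (descent lipᶠ p) ⟩
    g u + (length p + f v) ≡⟨ ℕ.+-assoc (g u) _ _ ⟨
    g u + length p + f v   ∎
    where open ≤-Reasoning
  detour {g} {f} {u = u} {v} {w} lipᵍ lipᶠ (_∷_ {v = u′} e p) (there w∈) = begin
    g w + f w                    ≤⟨ detour lipᵍ lipᶠ p w∈ ⟩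
    g u′ + length p + f v        ≤⟨ ℕ.+-monoˡ-≤ (f v) (ℕ.+-monoˡ-≤ (length p) (lipᵍ (symm G e))) ⟩
    suc (g u) + length p + f v   ≡⟨ cong (_+ f v) (ℕ.+-suc (g u) (length p)) ⟨
    g u + length (e ∷ p) + f v   ∎
    where open ≤-Reasoning

  record Passes (p : Walk G s t) (u v : Fin n) : Set where
    constructor passes
    field
      before  : Walk G s u
      between : Walk G u v
      after   : Walk G v t
      lengths : length before + length between + length after ≡ length p

  private
    pass : (e : Adj G w s) {p : Walk G s t} → Passes p u v → Passes (e ∷ p) u v
    pass e (passes a b c eq) = passes (e ∷ a) b c (cong suc eq)

    passes-from : (p : Walk G s t) → v ∈ˡ vertices p → Passes p s v
    passes-from [ s ]     (here refl) = passes [ s ] [ s ] [ s ] refl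
    passes-from p@(_ ∷ _) (here refl) = passes [ _ ] [ _ ] p refl
    passes-from (e ∷ p)   (there v∈)  with passes-from p v∈
    ... | passes a b c eq =
      passes [ _ ] (e ∷ (a ++ b)) c
        (cong suc (trans (cong (_+ length c) (length-++ a b)) eq))

  passes-in-some-order : (p : Walk G s t) → u ∈ˡ vertices p → v ∈ˡ vertices p →
                         Passes p u v ⊎ Passes p v u
  passes-in-some-order [ _ ]     (here refl) v∈          = inj₁ (passes-from _ v∈)
  passes-in-some-order p@(_ ∷ _) (here refl) v∈          = inj₁ (passes-from p v∈)
  passes-in-some-order p@(_ ∷ _) (there u∈)  (here refl) = inj₂ (passes-from p (there u∈))
  passes-in-some-order (e ∷ p)   (there u∈)  (there v∈)  =
    Sum.map (pass e) (pass e) (passes-in-some-order p u∈ v∈)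

  -- With g and f the distances from s and to t, the hypothesis says that p is
  -- the only shortest path from s to t.
  only-shortest⇒convex :
    Lipschitz g → Lipschitz f → (p : Walk G s t) →
    (∀ w → w ∈ fromList (vertices p) ⊎ g s + length p + f t < g w + f w) →
    Convex G (fromList (vertices p))
  only-shortest⇒convex {g} {f} {s} {t} lipᵍ lipᶠ p only {u} {v} u∈ v∈ q short =
    All.tabulate λ {w} w∈ → [ id , (λ far → contradiction (near w∈) (ℕ.<⇒≱ far)) ]′ (only w)
    where
    open ≤-Reasoning

    rearrange : ∀ a b c d e → (a + d) + b + (c + e) ≡ d + (a + b + c) + e
    rearrange = solve-∀

    -- Replacing the stretch of `p` between `x` and `y` by `q` does not lengthen `p`; the stretches
    -- before and after bound `g x` and `f y`.
    total : ∀ {x y} ((passes a b c _) : Passes p x y) → length q ≤ length b →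
            g x + length q + f y ≤ g s + length p + f t
    total {x} {y} (passes a b c eq) q≤b = begin
      g x + length q + f y
        ≤⟨ ℕ.+-mono-≤ (ℕ.+-mono-≤ (ascent lipᵍ a) q≤b) (descent lipᶠ c) ⟩
      (length a + g s) + length b + (length c + f t)
        ≡⟨ rearrange (length a) (length b) (length c) (g s) (f t) ⟩
      g s + (length a + length b + length c) + f t
        ≡⟨ cong (λ k → g s + k + f t) eq ⟩
      g s + length p + f t ∎

    near : ∀ {w} → w ∈ˡ vertices q → g w + f w ≤ g s + length p + f t
    near {w} w∈ with passes-in-some-order p (∈-fromList⁻ _ u∈) (∈-fromList⁻ _ v∈)
    ... | inj₁ pass@(passes _ b _ _) =
      ℕ.≤-trans (detour lipᵍ lipᶠ q w∈) (total pass (shortest-≤ short b))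
    -- Here `q` runs against the direction of `p`, so `f` and `g` exchange roles and `q` is compared
    -- with the reversed stretch.
    ... | inj₂ pass@(passes _ b _ _) = begin
      g w + f w            ≡⟨ ℕ.+-comm (g w) (f w) ⟩
      f w + g w            ≤⟨ detour lipᶠ lipᵍ q w∈ ⟩
      f u + length q + g v ≡⟨ swap (f u) (length q) (g v) ⟩
      g v + length q + f u ≤⟨ total pass (subst (length q ≤_) (length-reverse b)
                                (shortest-≤ short (reverse b))) ⟩
      g s + length p + f t ∎
      where
      swap : ∀ a b c → a + b + c ≡ c + b + a
      swap = solve-∀

-- Convex domination numbers

⊤-convexDominating : (G : Graph n) → ConvexDominating G ⊤
⊤-convexDominating G = (λ _ _ p _ → All.tabulate λ _ → ∈⊤) , λ _ → inj₁ ∈⊤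

-- Only ¬¬-existence, because convexity of a set is not shown to be decidable.
γcon-exists : (G : Graph n) → ¬ (∀ k → ¬ γcon G ≔ k)
γcon-exists {n} G none = descend ⊤ (⊤-convexDominating G) (<-wellFounded _)
  where
  descend : (A : Subset n) → ConvexDominating G A → Acc _<_ ∣ A ∣ → ⊥
  descend A cd (acc smaller) = none ∣ A ∣
    ((A , cd , refl) , λ B cdB → ℕ.≮⇒≥ λ B<A → descend B cdB (smaller B<A))

-- A running maximum is taken because `f` may fail to be monotone.
bounded : (f : ℕ → ℕ) (K : ℕ) → ∃[ B ] (∀ {k} → k ≤ K → f k ≤ B)
bounded f zero    = f 0 , λ { z≤n → ℕ.≤-refl }
bounded f (suc K) with bounded f K
... | B , f≤B = f (suc K) ⊔ B , λ k≤ →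
  [ (λ k<1+K → ℕ.≤-trans (f≤B (s≤s⁻¹ k<1+K)) (ℕ.m≤n⊔m _ B))
  , (λ { refl → ℕ.m≤m⊔n _ B }) ]′ (ℕ.m≤n⇒m<n∨m≡n k≤)

-- Shared by both halves of the theorem: if `B` bounds `f` up to `K`, the members of the families
-- with index `suc B` contradict the claim.
separated : (f : ℕ → ℕ) (K : ℕ) {s t : ℕ → ℕ}
            (G : ∀ m → Graph (s m)) (H : ∀ m → Graph (t m)) →
            (∀ m → ∃[ A ] ConvexDominating (G m) A × ∣ A ∣ ≤ K) →
            (∀ m A → ConvexDominating (H m) A → m ≤ ∣ A ∣) →
            ¬ (∀ m {k l} → γcon G m ≔ k → γcon H m ≔ l → l ≤ f k)
separated f K G H small large claim with bounded f K
... | B , f≤B =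
  -- The goal is absurdity, so the doubly negated existence of both numbers is enough.
  γcon-exists (G (suc B)) λ k γG@(_ , minimal) →
  γcon-exists (H (suc B)) λ { l γH@((A , cdA , refl) , _) →
    let (S , cdS , ∣S∣≤K) = small (suc B) in
    ℕ.<⇒≱ (large (suc B) A cdA)
      (ℕ.≤-trans (claim (suc B) γG γH) (f≤B (ℕ.≤-trans (minimal S cdS) ∣S∣≤K))) }

-- Graphs and prisms over a convenient vertex type

module Coding {V : Set} {n : ℕ} (code : Fin n ↔ V) where
  dec : Fin n → V
  dec = Inverse.to code

  enc : V → Fin n
  enc = Inverse.from code

  dec-enc : ∀ v → dec (enc v) ≡ v
  dec-enc = Inverse.strictlyInverseˡ code

  enc-dec : ∀ i → enc (dec i) ≡ i
  enc-dec = Inverse.strictlyInverseʳ code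

  _≟ᵛ_ : DecidableEquality V
  _≟ᵛ_ = via-injection (↔⇒↣ (↔-sym code)) _≟_

stops : ∀ {V : Set} {_~_ : Rel V 0ℓ} {u v} → Star _~_ u v → List V
stops {u = u} ε       = u ∷ []
stops {u = u} (_ ◅ r) = u ∷ stops r

module Coded {V : Set} {n : ℕ} (code : Fin n ↔ V) (G : Graph n) (_~_ : Rel V 0ℓ)
             (to~   : ∀ {i j} → Adj G i j → Inverse.to code i ~ Inverse.to code j)
             (from~ : ∀ {u v} → u ~ v → Adj G (Inverse.from code u) (Inverse.from code v))
             where

  open Coding code

  walk : ∀ {u v} → Star _~_ u v → Walk G (enc u) (enc v)
  walk ε       = [ _ ]
  walk (e ◅ r) = from~ e ∷ walk r

  vertices-walk : ∀ {u v} (r : Star _~_ u v) → vertices (walk r) ≡ List.map enc (stops r)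
  vertices-walk ε       = refl
  vertices-walk (_ ◅ r) = cong (_ ∷_) (vertices-walk r)

  connected : (r : V) → (∀ u → Star _~_ u r) → Connected G
  connected r route = rooted⇒connected (enc r) λ i →
    subst (λ j → Walk G j (enc r)) (enc-dec i) (walk (route (dec i)))

  Gradual : (V → ℕ) → Set
  Gradual h = ∀ {u v} → u ~ v → h u ≤ suc (h v)

  gradual⇒lipschitz : ∀ {h} → Gradual h → Lipschitz {G = G} (h ∘ dec)
  gradual⇒lipschitz grad e = grad (to~ e)

  -- The tool for lower bounds: the potential `h` certifies that the route is shortest, so convexity
  -- forces all its stops into `A`.
  convex-∋-steep : ∀ {h} → Gradual h → ∀ {A} → Convex G A →
                   ∀ {u v} → enc u ∈ A → enc v ∈ A →
                   (r : Star _~_ u v) → length (walk r) + h v ≤ h u →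
                   All (λ w → enc w ∈ A) (stops r)
  convex-∋-steep {h} grad {A} convex {u} {v} u∈ v∈ r steep =
    map⁻ (subst (All (_∈ A)) (vertices-walk r)
      (convex u∈ v∈ (walk r) (steep⇒shortest (gradual⇒lipschitz grad) (walk r)
        (subst₂ (λ x y → length (walk r) + h x ≤ h y) (sym (dec-enc v)) (sym (dec-enc u)) steep))))

  routeSet : ∀ {u v} → Star _~_ u v → Subset n
  routeSet r = fromList (vertices (walk r))

  ∈-routeSet : ∀ {u v w} (r : Star _~_ u v) → w ∈ˡ stops r → enc w ∈ routeSet r
  ∈-routeSet {w = w} r w∈ =
    ∈-fromList⁺ (subst (enc w ∈ˡ_) (sym (vertices-walk r)) (∈-map⁺ enc w∈))

  ∣routeSet∣≤ : ∀ {u v} (r : Star _~_ u v) → ∣ routeSet r ∣ ≤ List.length (stops r)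
  ∣routeSet∣≤ r = begin
    ∣ routeSet r ∣                       ≤⟨ ∣fromList∣≤length (vertices (walk r)) ⟩
    List.length (vertices (walk r))      ≡⟨ cong List.length (vertices-walk r) ⟩
    List.length (List.map enc (stops r)) ≡⟨ length-map enc (stops r) ⟩
    List.length (stops r)                ∎
    where open ≤-Reasoning

  -- The tool for upper bounds: uniqueness of the shortest route is reduced to one inequality for
  -- each vertex off the route.
  routeSet-convex : ∀ {g f} → Gradual g → Gradual f → ∀ {s t} (r : Star _~_ s t) →
                    (∀ w → w ∈ˡ stops r ⊎ g s + length (walk r) + f t < g w + f w) →
                    Convex G (routeSet r)
  routeSet-convex {g} {f} gradᵍ gradᶠ {s} {t} r only =
    only-shortest⇒convex (gradual⇒lipschitz gradᵍ) (gradual⇒lipschitz gradᶠ) (walk r) λ i →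
      Sum.map (subst (_∈ routeSet r) (enc-dec i) ∘ ∈-routeSet r)
        (subst₂ (λ x y → g x + length (walk r) + f y < g (dec i) + f (dec i))
          (sym (dec-enc s)) (sym (dec-enc t)))
        (only (dec i))

  routeSet-dominating : ∀ {s t} (r : Star _~_ s t) →
                        (∀ w → w ∈ˡ stops r ⊎ (∃[ u ] u ∈ˡ stops r × w ~ u)) →
                        Dominating G (routeSet r)
  routeSet-dominating r dom i with dom (dec i)
  ... | inj₁ i∈           = inj₁ (subst (_∈ _) (enc-dec i) (∈-routeSet r i∈))
  ... | inj₂ (u , u∈ , e) =
    inj₂ (enc u , ∈-routeSet r u∈ , subst (λ j → Adj G j (enc u)) (enc-dec i) (from~ e))

  dominated : ∀ {A} → Dominating G A → ∀ w → enc w ∈ A ⊎ (∃[ u ] enc u ∈ A × w ~ u)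
  dominated dom w with dom (enc w)
  ... | inj₁ w∈           = inj₁ w∈
  ... | inj₂ (i , i∈ , e) =
    inj₂ (dec i , subst (_∈ _) (sym (enc-dec i)) i∈ , subst (_~ dec i) (dec-enc w) (to~ e))

-- Boolean, so that for a concrete potential each kind of vertex is checked by evaluation and the
-- proof is `_`.
near : ℕ → ℕ → Bool
near a b = (a ≤ᵇ suc b) ∧ (b ≤ᵇ suc a)

near⇒≤ : ∀ a b → T (near a b) → a ≤ suc b × b ≤ suc a
near⇒≤ a b t = Product.map (ℕ.≤ᵇ⇒≤ a (suc b)) (ℕ.≤ᵇ⇒≤ b (suc a)) (Equivalence.to T-∧ t)

-- Each edge is listed in one direction only, which keeps the case analyses
-- below linear in the number of kinds of vertices.
module Prism {V : Set} {n : ℕ} (code : Fin n ↔ V) (n≢0 : NonZero n)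
             (out : V → List V) (loopless : ∀ v → v ∉ˡ out v)
             (σ : V → V) (σ-involutive : ∀ v → σ (σ v) ≡ v) where

  open Coding code
  open DecMembership _≟ᵛ_ using () renaming (_∈?_ to _∈ˡ?_)

  infix 4 _~_ _≈_

  _~_ : Rel V 0ℓ
  u ~ v = v ∈ˡ out u ⊎ u ∈ˡ out v

  G : Graph n
  G = record
    { nonempty = n≢0
    ; Adj      = λ i j → dec i ~ dec j
    ; adj?     = λ i j → (dec j ∈ˡ? out (dec i)) ⊎-dec (dec i ∈ˡ? out (dec j))
    ; symm     = Sum.swap
    ; irrefl   = λ { refl → [ loopless _ , loopless _ ]′ }
    }

  π : Permutation′ n
  π = permutation φ φ φ-involutive φ-involutive
    where
    φ : Fin n → Fin n
    φ = enc ∘ σ ∘ dec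
    φ-involutive : ∀ i → φ (φ i) ≡ i
    φ-involutive i = begin
      enc (σ (dec (enc (σ (dec i))))) ≡⟨ cong (enc ∘ σ) (dec-enc _) ⟩
      enc (σ (σ (dec i)))             ≡⟨ cong enc (σ-involutive _) ⟩
      enc (dec i)                     ≡⟨ enc-dec i ⟩
      i                               ∎
      where open ≡-Reasoning

  -- Prism adjacency on uncoded vertices. Since `σ` is its own inverse, the matching edge at a copy
  -- also leads to the image under `σ`.
  data _≈_ : Rel (V ⊎ V) 0ℓ where
    left   : ∀ {u v} → u ~ v → inj₁ u ≈ inj₁ v
    right  : ∀ {u v} → u ~ v → inj₂ u ≈ inj₂ v
    cross  : ∀ u → inj₁ u ≈ inj₂ (σ u)
    cross⁻ : ∀ u → inj₂ u ≈ inj₁ (σ u)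

  code² : Fin (n + n) ↔ (V ⊎ V)
  code² = ↔-trans +↔⊎ (code ⊎-↔ code)

  edge : ∀ {u v} → u ~ v → Adj G (enc u) (enc v)
  edge = subst₂ _~_ (sym (dec-enc _)) (sym (dec-enc _))

  private
    split≈ : ∀ x y → PrismAdj G π x y → Sum.map dec dec x ≈ Sum.map dec dec y
    split≈ (inj₁ i) (inj₁ j) e    = left e
    split≈ (inj₁ i) (inj₂ _) refl = subst (λ v → _ ≈ inj₂ v) (sym (dec-enc _)) (cross _)
    split≈ (inj₂ _) (inj₁ i) refl =
      subst₂ (λ u v → inj₂ u ≈ inj₁ v) (sym (dec-enc _)) (σ-involutive _) (cross⁻ _)
    split≈ (inj₂ i) (inj₂ j) e    = right e

    joined : ∀ {u v} → u ≈ v → PrismAdj G π (Sum.map enc enc u) (Sum.map enc enc v)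
    joined (left e)   = edge e
    joined (right e)  = edge e
    joined (cross u)  = cong (enc ∘ σ) (sym (dec-enc u))
    joined (cross⁻ u) = sym (begin
      enc (σ (dec (enc (σ u)))) ≡⟨ cong (enc ∘ σ) (dec-enc _) ⟩
      enc (σ (σ u))             ≡⟨ cong enc (σ-involutive u) ⟩
      enc u                     ∎)
      where open ≡-Reasoning

  prism⇒≈ : ∀ {i j} → Adj (prism G π) i j → Inverse.to code² i ≈ Inverse.to code² j
  prism⇒≈ {i} {j} = split≈ (splitAt n i) (splitAt n j)

  ≈⇒prism : ∀ {u v} → u ≈ v → Adj (prism G π) (Inverse.from code² u) (Inverse.from code² v)
  ≈⇒prism {u} {v} e = subst₂ (PrismAdj G π)
    (sym (splitAt-join n n (Sum.map enc enc u))) (sym (splitAt-join n n (Sum.map enc enc v)))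
    (joined e)

  module Base = Coded code G _~_ id edge

  module Double = Coded code² (prism G π) _≈_ prism⇒≈ ≈⇒prism

  -- Inspecting the listed direction of each edge suffices because `near` bounds the difference both
  -- ways.
  gentle : (V → ℕ) → V → Bool
  gentle h v = all (near (h v) ∘ h) (out v)

  base-gradual : ∀ h → (∀ v → T (gentle h v)) → Base.Gradual h
  base-gradual h h-gentle {u} {v} = λ where
      (inj₁ v∈) → proj₁ (slope u v∈)
      (inj₂ u∈) → proj₂ (slope v u∈)
    where
    slope : ∀ u {v} → v ∈ˡ out u → h u ≤ suc (h v) × h v ≤ suc (h u)
    slope u {v} v∈ = near⇒≤ (h u) (h v) (All.lookup (all⁺ _ (out u) (h-gentle u)) v∈)

  gentle² : (V ⊎ V → ℕ) → V → Bool
  gentle² h v = gentle (h ∘ inj₁) v ∧ gentle (h ∘ inj₂) v ∧ near (h (inj₁ v)) (h (inj₂ (σ v)))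

  double-gradual : ∀ h → (∀ v → T (gentle² h v)) → Double.Gradual h
  double-gradual h h-gentle = λ where
      (left e)   → base-gradual (h ∘ inj₁) (proj₁ ∘ parts) e
      (right e)  → base-gradual (h ∘ inj₂) (proj₁ ∘ proj₂ ∘ parts) e
      (cross u)  → proj₁ (slope u)
      -- The matching edge at the copy of `u` is the one that starts at `σ u` in the first copy.
      (cross⁻ u) → subst (λ v → h (inj₂ v) ≤ suc (h (inj₁ (σ u)))) (σ-involutive u)
                     (proj₂ (slope (σ u)))
    where
    parts : ∀ v → T (gentle (h ∘ inj₁) v) × T (gentle (h ∘ inj₂) v) ×
                  T (near (h (inj₁ v)) (h (inj₂ (σ v))))
    parts v = Product.map₂ (Equivalence.to T-∧) (Equivalence.to T-∧ (h-gentle v))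
    slope : ∀ v → h (inj₁ v) ≤ suc (h (inj₂ (σ v))) × h (inj₂ (σ v)) ≤ suc (h (inj₁ v))
    slope v = near⇒≤ (h (inj₁ v)) _ (proj₂ (proj₂ (parts v)))

-- The two families

module Broom (m : ℕ) where

  V : Set
  V = Fin 3 ⊎ Fin m

  pattern b₁ = inj₁ 0F
  pattern b₂ = inj₁ 1F
  pattern b₃ = inj₁ 2F
  pattern leaf i = inj₂ i

  out : V → List V
  out b₂       = b₁ ∷ b₃ ∷ []
  out (leaf _) = b₁ ∷ []
  out _        = []

  loopless : ∀ v → v ∉ˡ out v
  loopless b₂       (there (here ()))
  loopless b₂       (there (there ()))
  loopless (leaf _) (there ())

  σ : V → V
  σ b₁ = b₃
  σ b₃ = b₁
  σ v  = v

  σ-involutive : ∀ v → σ (σ v) ≡ v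
  σ-involutive b₁       = refl
  σ-involutive b₂       = refl
  σ-involutive b₃       = refl
  σ-involutive (leaf _) = refl

  open Prism {V} +↔⊎ _ out loopless σ σ-involutive public
  open Coding code² using () renaming (enc to enc²; dec to dec²; dec-enc to dec-enc²)

  connected : Connected G
  connected = Base.connected b₁ λ where
    b₁       → ε
    b₂       → inj₁ (here refl) ◅ ε
    b₃       → _◅_ {j = b₂} (inj₂ (there (here refl))) (inj₁ (here refl) ◅ ε)
    (leaf i) → inj₁ (here refl) ◅ ε

  spine : Star _~_ b₁ b₂
  spine = inj₂ (here refl) ◅ ε

  spine-convexDominating : ConvexDominating G (Base.routeSet spine)
  spine-convexDominating =
    Base.routeSet-convex (base-gradual g g-gentle) (base-gradual f f-gentle) spine only ,
    Base.routeSet-dominating spine λ where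
      b₁       → inj₁ (here refl)
      b₂       → inj₁ (there (here refl))
      b₃       → inj₂ (b₂ , there (here refl) , inj₂ (there (here refl)))
      (leaf i) → inj₂ (b₁ , here refl , inj₁ (here refl))
    where
    -- Distances from `b₁` and to `b₂`, cut off at 1; off the spine they still add up to 2, more
    -- than its length.
    g f : V → ℕ
    g b₁ = 0
    g _  = 1
    f b₂ = 0
    f _  = 1

    g-gentle : ∀ v → T (gentle g v)
    g-gentle b₁       = _
    g-gentle b₂       = _
    g-gentle b₃       = _
    g-gentle (leaf _) = _

    f-gentle : ∀ v → T (gentle f v)
    f-gentle b₁       = _
    f-gentle b₂       = _
    f-gentle b₃       = _
    f-gentle (leaf _) = _

    only : ∀ w → w ∈ˡ stops spine ⊎ 1 < g w + f w
    only b₁       = inj₁ (here refl)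
    only b₂       = inj₁ (there (here refl))
    only b₃       = inj₂ ℕ.≤-refl
    only (leaf _) = inj₂ ℕ.≤-refl

  large : (A : Subset _) → ConvexDominating (prism G π) A → m ≤ ∣ A ∣
  large A (convex , dominating) = injection⇒≤∣p∣ chosen chosen-injective (proj₁ ∘ proj₂ ∘ column)
    where
    -- The distances to `inj₂ b₁` in the prism; the drop of 3 from `inj₁ b₁` equals the length of
    -- `across i`.
    toB₁′ : V ⊎ V → ℕ
    toB₁′ (inj₁ b₃) = 1
    toB₁′ (inj₁ b₁) = 3
    toB₁′ (inj₁ _)  = 2
    toB₁′ (inj₂ b₁) = 0
    toB₁′ (inj₂ b₃) = 2
    toB₁′ (inj₂ _)  = 1

    toB₁′-gentle : ∀ v → T (gentle² toB₁′ v)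
    toB₁′-gentle b₁       = _
    toB₁′-gentle b₂       = _
    toB₁′-gentle b₃       = _
    toB₁′-gentle (leaf _) = _

    across : Fin m → Star _≈_ (inj₁ b₁) (inj₂ b₁)
    across i = left (inj₂ (here refl)) ◅ cross (leaf i) ◅ right (inj₁ (here refl)) ◅ ε

    leaf-neighbour : ∀ {i u} → leaf i ~ u → u ≡ b₁
    leaf-neighbour (inj₁ (here refl)) = refl
    leaf-neighbour {u = b₂} (inj₂ (there (here ())))
    leaf-neighbour {u = b₂} (inj₂ (there (there ())))
    leaf-neighbour {u = leaf _} (inj₂ (there ()))

    -- `[ id , id ]′` forgets the copy in which a vertex lies, so the condition says that the vertex
    -- belongs to column `i`.
    above : ∀ i w → enc² w ∈ A → [ id , id ]′ w ≡ leaf i →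
            ∃[ x ] x ∈ A × [ id , id ]′ (dec² x) ≡ leaf i
    above i w w∈ eq = enc² w , w∈ , trans (cong [ id , id ]′ (dec-enc² w)) eq

    column : ∀ i → ∃[ x ] x ∈ A × [ id , id ]′ (dec² x) ≡ leaf i
    column i with enc² (inj₁ b₁) ∈? A | enc² (inj₂ b₁) ∈? A
    ... | yes b₁∈ | yes b₁′∈
      with _ ∷ leaf∈ ∷ _ ← Double.convex-∋-steep (double-gradual toB₁′ toB₁′-gentle)
                             convex b₁∈ b₁′∈ (across i) ℕ.≤-refl
      = above i (inj₁ (leaf i)) leaf∈ refl
    -- Within its own copy the leaf has `b₁` as its sole neighbour, so without it the dominating
    -- vertex lies in the column.
    column i | no b₁∉ | _ with Double.dominated dominating (inj₁ (leaf i))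
    ... | inj₁ leaf∈               = above i (inj₁ (leaf i)) leaf∈ refl
    ... | inj₂ (_ , u∈ , left e)
      = contradiction (subst (λ u → enc² (inj₁ u) ∈ A) (leaf-neighbour e) u∈) b₁∉
    ... | inj₂ (_ , u∈ , cross _)  = above i (inj₂ (leaf i)) u∈ refl
    column i | yes _ | no b₁′∉ with Double.dominated dominating (inj₂ (leaf i))
    ... | inj₁ leaf∈               = above i (inj₂ (leaf i)) leaf∈ refl
    ... | inj₂ (_ , u∈ , right e)
      = contradiction (subst (λ u → enc² (inj₂ u) ∈ A) (leaf-neighbour e) u∈) b₁′∉
    ... | inj₂ (_ , u∈ , cross⁻ _) = above i (inj₁ (leaf i)) u∈ refl

    chosen : Fin m → Fin _
    chosen = proj₁ ∘ column

    -- Distinct columns are disjoint: a chosen vertex determines its column.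
    chosen-injective : Injective _≡_ _≡_ chosen
    chosen-injective {i} {j} eq = inj₂-injective (begin
      leaf i                           ≡⟨ proj₂ (proj₂ (column i)) ⟨
      [ id , id ]′ (dec² (chosen i))   ≡⟨ cong ([ id , id ]′ ∘ dec²) eq ⟩
      [ id , id ]′ (dec² (chosen j))   ≡⟨ proj₂ (proj₂ (column j)) ⟩
      leaf j                           ∎)
      where open ≡-Reasoning

-- The z i serve only as σ-partners of the x i: were x i fixed by σ, the path
-- y, x i, x i′, a′ would be another shortest path from y to a′ in the prism.
module Lantern (m : ℕ) where

  V : Set
  V = Fin 5 ⊎ (Fin m ⊎ Fin m)

  pattern a⁺ = inj₁ 0F
  pattern a  = inj₁ 1F
  pattern x₀ = inj₁ 2F
  pattern y  = inj₁ 3F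
  pattern y⁺ = inj₁ 4F
  pattern x i = inj₂ (inj₁ i)
  pattern z i = inj₂ (inj₂ i)

  out : V → List V
  out a⁺    = a ∷ []
  out x₀    = a ∷ y ∷ []
  out y⁺    = y ∷ []
  out (x _) = a ∷ y ∷ []
  out (z _) = x₀ ∷ []
  out _     = []

  loopless : ∀ v → v ∉ˡ out v
  loopless a⁺    (there ())
  loopless x₀    (there (here ()))
  loopless x₀    (there (there ()))
  loopless y⁺    (there ())
  loopless (x _) (there (here ()))
  loopless (x _) (there (there ()))
  loopless (z _) (there ())

  -- Exchanging hubs with pendants makes `inj₂ a` dominate `inj₁ a⁺` and `inj₁ y` dominate
  -- `inj₂ y⁺`; fixing `x₀` supplies the middle edge of `bridge`.
  σ : V → V
  σ a⁺    = a
  σ a     = a⁺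
  σ x₀    = x₀
  σ y     = y⁺
  σ y⁺    = y
  σ (x i) = z i
  σ (z i) = x i

  σ-involutive : ∀ v → σ (σ v) ≡ v
  σ-involutive a⁺    = refl
  σ-involutive a     = refl
  σ-involutive x₀    = refl
  σ-involutive y     = refl
  σ-involutive y⁺    = refl
  σ-involutive (x _) = refl
  σ-involutive (z _) = refl

  code : Fin (5 + (m + m)) ↔ V
  code = ↔-trans +↔⊎ (↔-refl ⊎-↔ +↔⊎)

  open Prism code _ out loopless σ σ-involutive public
  open Coding code using (enc; dec; dec-enc)

  a⁺~a : a⁺ ~ a
  a⁺~a = inj₁ (here refl)

  x₀~a : x₀ ~ a
  x₀~a = inj₁ (here refl)

  x₀~y : x₀ ~ y
  x₀~y = inj₁ (there (here refl))

  x~a : ∀ {i} → x i ~ a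
  x~a = inj₁ (here refl)

  x~y : ∀ {i} → x i ~ y
  x~y = inj₁ (there (here refl))

  y⁺~y : y⁺ ~ y
  y⁺~y = inj₁ (here refl)

  z~x₀ : ∀ {i} → z i ~ x₀
  z~x₀ = inj₁ (here refl)

  connected : Connected G
  connected = Base.connected x₀ λ where
    a⁺    → a⁺~a ◅ Sum.swap x₀~a ◅ ε
    a     → Sum.swap x₀~a ◅ ε
    x₀    → ε
    y     → Sum.swap x₀~y ◅ ε
    y⁺    → y⁺~y ◅ Sum.swap x₀~y ◅ ε
    (x i) → x~a {i} ◅ Sum.swap x₀~a ◅ ε
    (z i) → z~x₀ {i} ◅ ε

  bridge : Star _≈_ (inj₁ y) (inj₂ a)
  bridge = left (Sum.swap x₀~y) ◅ cross x₀ ◅ right x₀~a ◅ ε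

  bridge-convexDominating : ConvexDominating (prism G π) (Double.routeSet bridge)
  bridge-convexDominating =
    Double.routeSet-convex (double-gradual fromY fromY-gentle) (double-gradual toA′ toA′-gentle)
      bridge only ,
    Double.routeSet-dominating bridge λ where
      (inj₁ a⁺)    → inj₂ (inj₂ a , a′∈ , cross a⁺)
      (inj₁ a)     → inj₂ (inj₁ x₀ , x₀∈ , left (Sum.swap x₀~a))
      (inj₁ x₀)    → inj₁ x₀∈
      (inj₁ y)     → inj₁ y∈
      (inj₁ y⁺)    → inj₂ (inj₁ y , y∈ , left y⁺~y)
      (inj₁ (x i)) → inj₂ (inj₁ y , y∈ , left (x~y {i}))
      (inj₁ (z i)) → inj₂ (inj₁ x₀ , x₀∈ , left (z~x₀ {i}))
      (inj₂ a⁺)    → inj₂ (inj₂ a , a′∈ , right a⁺~a)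
      (inj₂ a)     → inj₁ a′∈
      (inj₂ x₀)    → inj₁ x₀′∈
      (inj₂ y)     → inj₂ (inj₂ x₀ , x₀′∈ , right (Sum.swap x₀~y))
      (inj₂ y⁺)    → inj₂ (inj₁ y , y∈ , cross⁻ y⁺)
      (inj₂ (x i)) → inj₂ (inj₂ a , a′∈ , right (x~a {i}))
      (inj₂ (z i)) → inj₂ (inj₂ x₀ , x₀′∈ , right (z~x₀ {i}))
    where
    y∈ : inj₁ y ∈ˡ stops bridge
    y∈ = here refl
    x₀∈ : inj₁ x₀ ∈ˡ stops bridge
    x₀∈ = there (here refl)
    x₀′∈ : inj₂ x₀ ∈ˡ stops bridge
    x₀′∈ = there (there (here refl))
    a′∈ : inj₂ a ∈ˡ stops bridge
    a′∈ = there (there (there (here refl)))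

    -- The distances from `inj₁ y` and to `inj₂ a` in the prism; their sum is 3 on the bridge and 4
    -- at every other vertex.
    fromY toA′ : V ⊎ V → ℕ
    fromY (inj₁ a⁺)    = 3
    fromY (inj₁ a)     = 2
    fromY (inj₁ x₀)    = 1
    fromY (inj₁ y)     = 0
    fromY (inj₁ y⁺)    = 1
    fromY (inj₁ (x _)) = 1
    fromY (inj₁ (z _)) = 2
    fromY (inj₂ a⁺)    = 3
    fromY (inj₂ a)     = 3
    fromY (inj₂ x₀)    = 2
    fromY (inj₂ y)     = 2
    fromY (inj₂ y⁺)    = 1
    fromY (inj₂ (x _)) = 3
    fromY (inj₂ (z _)) = 2
    toA′ (inj₁ a⁺)    = 1
    toA′ (inj₁ a)     = 2
    toA′ (inj₁ x₀)    = 2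
    toA′ (inj₁ y)     = 3
    toA′ (inj₁ y⁺)    = 3
    toA′ (inj₁ (x _)) = 3
    toA′ (inj₁ (z _)) = 2
    toA′ (inj₂ a⁺)    = 1
    toA′ (inj₂ a)     = 0
    toA′ (inj₂ x₀)    = 1
    toA′ (inj₂ y)     = 2
    toA′ (inj₂ y⁺)    = 3
    toA′ (inj₂ (x _)) = 1
    toA′ (inj₂ (z _)) = 2

    fromY-gentle : ∀ v → T (gentle² fromY v)
    fromY-gentle a⁺    = _
    fromY-gentle a     = _
    fromY-gentle x₀    = _
    fromY-gentle y     = _
    fromY-gentle y⁺    = _
    fromY-gentle (x _) = _
    fromY-gentle (z _) = _

    toA′-gentle : ∀ v → T (gentle² toA′ v)
    toA′-gentle a⁺    = _
    toA′-gentle a     = _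
    toA′-gentle x₀    = _
    toA′-gentle y     = _
    toA′-gentle y⁺    = _
    toA′-gentle (x _) = _
    toA′-gentle (z _) = _

    only : ∀ w → w ∈ˡ stops bridge ⊎ 3 < fromY w + toA′ w
    only (inj₁ a⁺)    = inj₂ ℕ.≤-refl
    only (inj₁ a)     = inj₂ ℕ.≤-refl
    only (inj₁ x₀)    = inj₁ x₀∈
    only (inj₁ y)     = inj₁ y∈
    only (inj₁ y⁺)    = inj₂ ℕ.≤-refl
    only (inj₁ (x _)) = inj₂ ℕ.≤-refl
    only (inj₁ (z _)) = inj₂ ℕ.≤-refl
    only (inj₂ a⁺)    = inj₂ ℕ.≤-refl
    only (inj₂ a)     = inj₁ a′∈
    only (inj₂ x₀)    = inj₁ x₀′∈
    only (inj₂ y)     = inj₂ ℕ.≤-refl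
    only (inj₂ y⁺)    = inj₂ ℕ.≤-refl
    only (inj₂ (x _)) = inj₂ ℕ.≤-refl
    only (inj₂ (z _)) = inj₂ ℕ.≤-refl

  large : (A : Subset _) → ConvexDominating G A → m ≤ ∣ A ∣
  large A (convex , dominating) = injection⇒≤∣p∣ (λ i → enc (x i)) x-injective x∈
    where
    x-injective : Injective _≡_ _≡_ (λ i → enc (x i))
    x-injective {i} {j} eq = inj₁-injective (inj₂-injective (begin
      x i             ≡⟨ dec-enc (x i) ⟨
      dec (enc (x i)) ≡⟨ cong dec eq ⟩
      dec (enc (x j)) ≡⟨ dec-enc (x j) ⟩
      x j             ∎))
      where open ≡-Reasoning

    -- Distance to `y⁺`, except at `z i`, where 2 replaces 3 and the slopes remain admissible.
    toY⁺ : V → ℕ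
    toY⁺ a⁺ = 4
    toY⁺ a  = 3
    toY⁺ y  = 1
    toY⁺ y⁺ = 0
    toY⁺ _  = 2

    toY⁺-gentle : ∀ v → T (gentle toY⁺ v)
    toY⁺-gentle a⁺    = _
    toY⁺-gentle a     = _
    toY⁺-gentle x₀    = _
    toY⁺-gentle y     = _
    toY⁺-gentle y⁺    = _
    toY⁺-gentle (x _) = _
    toY⁺-gentle (z _) = _

    only-a⁺~ : ∀ {u} → a⁺ ~ u → u ≡ a
    only-a⁺~ (inj₁ (here refl)) = refl
    only-a⁺~ {x₀}  (inj₂ (there (here ())))
    only-a⁺~ {x₀}  (inj₂ (there (there ())))
    only-a⁺~ {a⁺}  (inj₂ (there ()))
    only-a⁺~ {y⁺}  (inj₂ (there ()))
    only-a⁺~ {x _} (inj₂ (there (here ())))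
    only-a⁺~ {x _} (inj₂ (there (there ())))
    only-a⁺~ {z _} (inj₂ (there ()))

    only-y⁺~ : ∀ {u} → y⁺ ~ u → u ≡ y
    only-y⁺~ (inj₁ (here refl)) = refl
    only-y⁺~ {x₀}  (inj₂ (there (here ())))
    only-y⁺~ {x₀}  (inj₂ (there (there ())))
    only-y⁺~ {a⁺}  (inj₂ (there ()))
    only-y⁺~ {y⁺}  (inj₂ (there ()))
    only-y⁺~ {x _} (inj₂ (there (here ())))
    only-y⁺~ {x _} (inj₂ (there (there ())))
    only-y⁺~ {z _} (inj₂ (there ()))

    -- Meant for the pendants `a⁺` and `y⁺`, whose hubs take the place of `h`.
    support : ∀ v {h} → (∀ {u} → v ~ u → u ≡ h) → enc v ∈ A ⊎ enc h ∈ A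
    support v only-h with Base.dominated dominating v
    ... | inj₁ v∈           = inj₁ v∈
    ... | inj₂ (_ , u∈ , e) = inj₂ (subst (λ u → enc u ∈ A) (only-h e) u∈)

    steep : ∀ {u v} → enc u ∈ A → enc v ∈ A → (r : Star _~_ u v) →
            length (Base.walk r) + toY⁺ v ≤ toY⁺ u → All (λ w → enc w ∈ A) (stops r)
    steep = Base.convex-∋-steep (base-gradual toY⁺ toY⁺-gentle) convex

    x∈ : ∀ i → enc (x i) ∈ A
    -- In all four cases the route through `x i` is a segment of the one from `a⁺` to `y⁺`, so
    -- `toY⁺` certifies each of them.
    x∈ i with support a⁺ only-a⁺~ | support y⁺ only-y⁺~
    ... | inj₁ a⁺∈ | inj₁ y⁺∈
      with _ ∷ _ ∷ x∈ ∷ _ ←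
        steep a⁺∈ y⁺∈ (a⁺~a ◅ Sum.swap (x~a {i}) ◅ x~y {i} ◅ Sum.swap y⁺~y ◅ ε) ℕ.≤-refl = x∈
    ... | inj₁ a⁺∈ | inj₂ y∈
      with _ ∷ _ ∷ x∈ ∷ _ ← steep a⁺∈ y∈ (a⁺~a ◅ Sum.swap (x~a {i}) ◅ x~y {i} ◅ ε) ℕ.≤-refl = x∈
    ... | inj₂ a∈ | inj₁ y⁺∈
      with _ ∷ x∈ ∷ _ ← steep a∈ y⁺∈ (Sum.swap (x~a {i}) ◅ x~y {i} ◅ Sum.swap y⁺~y ◅ ε) ℕ.≤-refl = x∈
    ... | inj₂ a∈ | inj₂ y∈
      with _ ∷ x∈ ∷ _ ← steep a∈ y∈ (Sum.swap (x~a {i}) ◅ x~y {i} ◅ ε) ℕ.≤-refl = x∈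

mainTheorem3 : (¬ (Σ[ f ∈ (ℕ → ℕ) ]
    (∀ {n} (G : Graph n) → Connected G → (π : Permutation′ n) →
    ∀ {k l} → γcon G ≔ k → γcon (prism G π) ≔ l → l ≤ f k)))
    ×
    (¬ (Σ[ f ∈ (ℕ → ℕ) ]
    (∀ {n} (G : Graph n) → Connected G → (π : Permutation′ n) →
    ∀ {k l} → γcon G ≔ k → γcon (prism G π) ≔ l → k ≤ f l)))
mainTheorem3 =
  -- The bound 2 counts the stops of `spine`.
  (λ { (f , bound) → separated f 2 Broom.G (λ m → prism (Broom.G m) (Broom.π m))
         (λ m → _ , Broom.spine-convexDominating m , Broom.Base.∣routeSet∣≤ m (Broom.spine m))
         Broom.large
         (λ m γG γπG → bound (Broom.G m) (Broom.connected m) (Broom.π m) γG γπG) }) ,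
  -- Graph and prism exchange roles; 4 counts the stops of `bridge`.
  (λ { (f , bound) → separated f 4 (λ m → prism (Lantern.G m) (Lantern.π m)) Lantern.G
         (λ m → _ , Lantern.bridge-convexDominating m ,
                    Lantern.Double.∣routeSet∣≤ m (Lantern.bridge m))
         Lantern.large
         (λ m γπG γG → bound (Lantern.G m) (Lantern.connected m) (Lantern.π m) γG γπG) })
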